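{- A trace on the symmetric monoidal category $\mathbf{Stream}_{\mathcal I}$ is given by sending a morphism $f\colon(\mathbf V^{x+m})^\omega\to(\mathbf V^{x+n})^\omega$ to the stream function $\sigma\mapsto\pi_1(f(\mu_f(\sigma),\sigma))$, where $\mu_f(\sigma)$ is the least fixed point of the function $\tau\mapsto\pi_0(f(\tau,\sigma))$ for fixed $\sigma$. That is, with this operation $\mathbf{Stream}_{\mathcal I}$ is a symmetric traced monoidal category.
   Context: $\mathbf V$ is a finite lattice with order $\sqsubseteq$ and least element $\bot$. For a set $A$, $A^\omega$ is the set of streams over $A$; streams over a poset are ordered pointwise, and powers $\mathbf V^m$ are ordered pointwise. We identify $(\mathbf V^{x+m})^\omega\cong(\mathbf V^x)^\omega\times(\mathbf V^m)^\omega$, writing $(\tau,\sigma)$ for elements, and $\pi_0,\pi_1$ for the projections of a stream in $(\mathbf V^{x+n})^\omega$ to its $(\mathbf V^x)^\omega$ and $(\mathbf V^n)^\omega$ components. A stream function $f\colon A^\omega\to B^\omega$ is causal if $\sigma(j)=\tau(j)$ for all $j\le i$ implies $f(\sigma)(i)=f(\tau)(i)$. The functional stream derivative is $f_a\coloneqq\sigma\mapsto\mathrm{tl}(f(a::\sigma))$, where $\mathrm{tl}(\rho)(i)=\rho(i+1)$, extended to finite words by $f_\varepsilon=f$, $f_{a::\overline b}=(f_a)_{\overline b}$; $f$ is finitely specified if $\{f_{\overline a}\mid\overline a\in A^\star\}$ is finite. $f$ is $\bot$-preserving if it maps the least stream to the least stream. $\mathbf{Stream}_{\mathcal I}$ is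 the PROP (strict symmetric monoidal category with objects the natural numbers and addition as tensor on objects) whose morphisms $m\to n$ are the causal, finitely specified, $\bot$-preserving, monotone stream functions $(\mathbf V^m)^\omega\to(\mathbf V^n)^\omega$, with composition of functions, Cartesian product of functions as tensor, and the swap of streams as symmetry. A trace on a symmetric monoidal category is a family of functions $\mathrm{Tr}^X_{A,B}\colon\mathcal C(X\otimes A,X\otimes B)\to\mathcal C(A,B)$ satisfying the usual axioms of Joyal–Street–Verity for symmetric traced monoidal categories (tightening, sliding, yanking, vanishing, superposing). -}

module Defs where

open import Algebra.Core using (Op₂)
open import Algebra.Structures using (IsMonoid)
open import Data.Fin.Base using (Fin)
open import Data.List.Base using (List; []; _∷_; cartesianProductWith)
import Data.List.Base as List
open import Data.List.Relation.Unary.Any using (Any; here)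
import Data.List.Relation.Unary.Any.Properties as Any
open import Data.Nat.Base using (ℕ; zero; suc; _+_; _≤_; s≤s)
open import Data.Nat.Properties using (≤-refl; ≤-trans; +-assoc; +-0-isMonoid; +-identityʳ)
open import Data.Product.Base using (∃-syntax; _,_)
open import Data.Vec.Base using (Vec; []; _∷_; _++_; take; drop; replicate; cast)
open import Data.Vec.Properties
  using (take++drop≡id; cast-is-id; ++-assoc-eqFree; ++-identityʳ-eqFree)
open import Data.Vec.Relation.Binary.Pointwise.Inductive as Pointwise
  using (Pointwise; []; _∷_)
open import Function.Bundles using (_↔_)
open import Level using (Level; _⊔_; 0ℓ) renaming (suc to lsuc)
open import Relation.Binary.Core using (Rel)
open import Relation.Binary.Definitions using (Minimum)
open import Relation.Binary.Lattice.Structures using (IsLattice)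
open import Relation.Binary.PropositionalEquality
  using (_≡_; refl; sym; trans; cong; cong₂; subst)
open import Relation.Binary.Structures using (IsEquivalence)

-- Strictness: the tensor on objects is a monoid up to _≡_, and the
-- associativity and unit laws for arrows hold once their endpoints are
-- identified along these equations.  The identification is `coe`, the
-- identity arrow transported along an equation of objects.
record SymmetricStrictMonoidalCategory (o ℓ e : Level) : Set (lsuc (o ⊔ ℓ ⊔ e)) where
  infix  1 _⇒_
  infix  4 _≈_
  infixr 9 _∘_
  infixr 10 _⊗₀_ _⊗₁_
  field
    Obj : Set o
    _⇒_ : Obj → Obj → Set ℓ
    _≈_ : ∀ {A B} → Rel (A ⇒ B) e
    id  : ∀ {A} → A ⇒ A
    _∘_ : ∀ {A B C} → B ⇒ C → A ⇒ B → A ⇒ C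

    isEquivalence : ∀ {A B} → IsEquivalence (_≈_ {A} {B})
    ∘-resp-≈  : ∀ {A B C} {f f′ : B ⇒ C} {g g′ : A ⇒ B} →
                f ≈ f′ → g ≈ g′ → f ∘ g ≈ f′ ∘ g′
    assoc     : ∀ {A B C D} (h : C ⇒ D) (g : B ⇒ C) (f : A ⇒ B) →
                (h ∘ g) ∘ f ≈ h ∘ (g ∘ f)
    identityˡ : ∀ {A B} (f : A ⇒ B) → id ∘ f ≈ f
    identityʳ : ∀ {A B} (f : A ⇒ B) → f ∘ id ≈ f

    unit         : Obj
    _⊗₀_         : Op₂ Obj
    ⊗₀-isMonoid  : IsMonoid _≡_ _⊗₀_ unit
    _⊗₁_         : ∀ {A B C D} → A ⇒ B → C ⇒ D → (A ⊗₀ C) ⇒ (B ⊗₀ D)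

  coe : ∀ {A B} → A ≡ B → A ⇒ B
  coe {A} p = subst (A ⇒_) p id

  module ⊗₀ = IsMonoid ⊗₀-isMonoid

  α : ∀ A B C → (A ⊗₀ B) ⊗₀ C ⇒ A ⊗₀ (B ⊗₀ C)
  α A B C = coe (⊗₀.assoc A B C)

  α⁻¹ : ∀ A B C → A ⊗₀ (B ⊗₀ C) ⇒ (A ⊗₀ B) ⊗₀ C
  α⁻¹ A B C = coe (sym (⊗₀.assoc A B C))

  lu : ∀ A → unit ⊗₀ A ⇒ A
  lu A = coe (⊗₀.identityˡ A)

  lu⁻¹ : ∀ A → A ⇒ unit ⊗₀ A
  lu⁻¹ A = coe (sym (⊗₀.identityˡ A))

  ru : ∀ A → A ⊗₀ unit ⇒ A
  ru A = coe (⊗₀.identityʳ A)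

  field
    ⊗-resp-≈     : ∀ {A B C D} {f f′ : A ⇒ B} {g g′ : C ⇒ D} →
                   f ≈ f′ → g ≈ g′ → f ⊗₁ g ≈ f′ ⊗₁ g′
    ⊗-identity   : ∀ {A B} → id {A} ⊗₁ id {B} ≈ id
    ⊗-∘          : ∀ {A B C A′ B′ C′}
                   (g : B ⇒ C) (f : A ⇒ B) (g′ : B′ ⇒ C′) (f′ : A′ ⇒ B′) →
                   (g ∘ f) ⊗₁ (g′ ∘ f′) ≈ (g ⊗₁ g′) ∘ (f ⊗₁ f′)
    ⊗₁-assoc     : ∀ {A B C A′ B′ C′} (f : A ⇒ A′) (g : B ⇒ B′) (h : C ⇒ C′) →
                   α A′ B′ C′ ∘ ((f ⊗₁ g) ⊗₁ h) ≈ (f ⊗₁ (g ⊗₁ h)) ∘ α A B C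
    ⊗₁-identityˡ : ∀ {A B} (f : A ⇒ B) → lu B ∘ (id {unit} ⊗₁ f) ≈ f ∘ lu A
    ⊗₁-identityʳ : ∀ {A B} (f : A ⇒ B) → ru B ∘ (f ⊗₁ id {unit}) ≈ f ∘ ru A

    swap            : ∀ A B → A ⊗₀ B ⇒ B ⊗₀ A
    swap-natural    : ∀ {A B C D} (f : A ⇒ B) (g : C ⇒ D) →
                      swap B D ∘ (f ⊗₁ g) ≈ (g ⊗₁ f) ∘ swap A C
    swap-involutive : ∀ A B → swap B A ∘ swap A B ≈ id
    hexagon         : ∀ A B C →
                      α B C A ∘ (swap A (B ⊗₀ C) ∘ α A B C) ≈
                      (id {B} ⊗₁ swap A C) ∘ (α B A C ∘ (swap A B ⊗₁ id {C}))

module _ {o ℓ e} (𝒞 : SymmetricStrictMonoidalCategory o ℓ e) where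
  open SymmetricStrictMonoidalCategory 𝒞

  TraceOperator : Set (o ⊔ ℓ)
  TraceOperator = ∀ X A B → (X ⊗₀ A ⇒ X ⊗₀ B) → (A ⇒ B)

  record IsTrace (Tr : TraceOperator) : Set (o ⊔ ℓ ⊔ e) where
    field
      -- Hom-sets are setoids, so being a function on them is a condition.
      resp-≈ : ∀ X A B {f g : X ⊗₀ A ⇒ X ⊗₀ B} → f ≈ g → Tr X A B f ≈ Tr X A B g

      tightening : ∀ X {A B C D} (g : A ⇒ B) (f : X ⊗₀ B ⇒ X ⊗₀ C) (h : C ⇒ D) →
        Tr X A D ((id {X} ⊗₁ h) ∘ (f ∘ (id {X} ⊗₁ g))) ≈ h ∘ (Tr X B C f ∘ g)

      sliding : ∀ {X Y A B} (f : X ⊗₀ A ⇒ Y ⊗₀ B) (u : Y ⇒ X) →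
        Tr X A B ((u ⊗₁ id {B}) ∘ f) ≈ Tr Y A B (f ∘ (u ⊗₁ id {A}))

      vanishing-unit : ∀ {A B} (f : unit ⊗₀ A ⇒ unit ⊗₀ B) →
        Tr unit A B f ≈ lu B ∘ (f ∘ lu⁻¹ A)

      vanishing-⊗ : ∀ X Y {A B} (f : (X ⊗₀ Y) ⊗₀ A ⇒ (X ⊗₀ Y) ⊗₀ B) →
        Tr (X ⊗₀ Y) A B f ≈
        Tr Y A B (Tr X (Y ⊗₀ A) (Y ⊗₀ B) (α X Y B ∘ (f ∘ α⁻¹ X Y A)))

      superposing : ∀ X {A B C D} (f : X ⊗₀ A ⇒ X ⊗₀ B) (g : C ⇒ D) →
        Tr X (A ⊗₀ C) (B ⊗₀ D) (α X B D ∘ ((f ⊗₁ g) ∘ α⁻¹ X A C)) ≈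
        Tr X A B f ⊗₁ g

      yanking : ∀ X → Tr X X X (swap X X) ≈ id

Stream : Set → Set
Stream A = ℕ → A

infix 4 _≈ˢ_
_≈ˢ_ : {A : Set} → Rel (Stream A) 0ℓ
σ ≈ˢ τ = ∀ i → σ i ≡ τ i

infixr 5 _∷ˢ_
_∷ˢ_ : {A : Set} → A → Stream A → Stream A
(a ∷ˢ σ) zero    = a
(a ∷ˢ σ) (suc i) = σ i

tl : {A : Set} → Stream A → Stream A
tl σ i = σ (suc i)

module _ {A B : Set} where

  infix 4 _≐_
  _≐_ : Rel (Stream A → Stream B) 0ℓ
  f ≐ g = ∀ σ → f σ ≈ˢ g σ

  Causal : (Stream A → Stream B) → Set
  Causal f = ∀ σ τ i → (∀ j → j ≤ i → σ j ≡ τ j) → f σ i ≡ f τ i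

  derivative₁ : (Stream A → Stream B) → A → Stream A → Stream B
  derivative₁ f a σ = tl (f (a ∷ˢ σ))

  derivative : (Stream A → Stream B) → List A → Stream A → Stream B
  derivative f []       = f
  derivative f (a ∷ as) = derivative (derivative₁ f a) as

  -- The set { derivative f as | as } is finite: up to extensional equality,
  -- all its members occur in one finite list of stream functions.
  FinitelySpecified : (Stream A → Stream B) → Set
  FinitelySpecified f = ∃[ gs ] ∀ as → Any (λ g → derivative f as ≐ g) gs

record IsLeastFixedPoint {a ℓ₁ ℓ₂} {A : Set a} (_≈_ : Rel A ℓ₁) (_⊑_ : Rel A ℓ₂)
                         (g : A → A) (μ : A) : Set (a ⊔ ℓ₁ ⊔ ℓ₂) where
  field
    fixed : g μ ≈ μ
    least : ∀ τ → g τ ≈ τ → μ ⊑ τ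

module _ {A : Set} {m n : ℕ} where

  pair : Stream (Vec A m) → Stream (Vec A n) → Stream (Vec A (m + n))
  pair τ σ i = τ i ++ σ i

module _ {A : Set} (m : ℕ) {n : ℕ} where

  π₀ : Stream (Vec A (m + n)) → Stream (Vec A m)
  π₀ ρ i = take m (ρ i)

  π₁ : Stream (Vec A (m + n)) → Stream (Vec A n)
  π₁ ρ i = drop m (ρ i)

module _ {A : Set} where

  take-++ : ∀ {m n} (xs : Vec A m) (ys : Vec A n) → take m (xs ++ ys) ≡ xs
  take-++ []       ys = refl
  take-++ (x ∷ xs) ys = cong (x ∷_) (take-++ xs ys)

  drop-++ : ∀ {m n} (xs : Vec A m) (ys : Vec A n) → drop m (xs ++ ys) ≡ ys
  drop-++ []       ys = refl
  drop-++ (x ∷ xs) ys = drop-++ xs ys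

  take-replicate : ∀ m n (a : A) → take m (replicate (m + n) a) ≡ replicate m a
  take-replicate zero    n a = refl
  take-replicate (suc m) n a = cong (a ∷_) (take-replicate m n a)

  drop-replicate : ∀ m n (a : A) → drop m (replicate (m + n) a) ≡ replicate n a
  drop-replicate zero    n a = refl
  drop-replicate (suc m) n a = drop-replicate m n a

  replicate-++ : ∀ m n (a : A) → replicate m a ++ replicate n a ≡ replicate (m + n) a
  replicate-++ zero    n a = refl
  replicate-++ (suc m) n a = cong (a ∷_) (replicate-++ m n a)

  take-take : ∀ m n o (v : Vec A ((m + n) + o)) →
              take m (cast (+-assoc m n o) v) ≡ take m (take (m + n) v)
  take-take zero    n o v       = refl
  take-take (suc m) n o (x ∷ v) = cong (x ∷_) (take-take m n o v)

  take-drop : ∀ m n o (v : Vec A ((m + n) + o)) →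
              take n (drop m (cast (+-assoc m n o) v)) ≡ drop m (take (m + n) v)
  take-drop zero    n o v       = cong (take n) (cast-is-id refl v)
  take-drop (suc m) n o (x ∷ v) = take-drop m n o v

  drop-drop : ∀ m n o (v : Vec A ((m + n) + o)) →
              drop n (drop m (cast (+-assoc m n o) v)) ≡ drop (m + n) v
  drop-drop zero    n o v       = cong (drop n) (cast-is-id refl v)
  drop-drop (suc m) n o (x ∷ v) = drop-drop m n o v

  cast-++-unitʳ : ∀ {m} (xs : Vec A m) (ys : Vec A 0) →
                  cast (+-identityʳ m) (xs ++ ys) ≡ xs
  cast-++-unitʳ xs [] = ++-identityʳ-eqFree xs

  take-unitʳ : ∀ m (v : Vec A (m + 0)) → take m v ≡ cast (+-identityʳ m) v
  take-unitʳ zero    []      = refl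
  take-unitʳ (suc m) (x ∷ v) = cong (x ∷_) (take-unitʳ m v)

module _ {A : Set} {R : Rel A 0ℓ} where

  take⁺ : ∀ m {n} {xs ys : Vec A (m + n)} → Pointwise R xs ys →
          Pointwise R (take m xs) (take m ys)
  take⁺ zero    rs       = []
  take⁺ (suc m) {xs = _ ∷ _} {ys = _ ∷ _} (r ∷ rs) = r ∷ take⁺ m rs

  drop⁺ : ∀ m {n} {xs ys : Vec A (m + n)} → Pointwise R xs ys →
          Pointwise R (drop m xs) (drop m ys)
  drop⁺ zero    rs       = rs
  drop⁺ (suc m) {xs = _ ∷ _} {ys = _ ∷ _} (r ∷ rs) = drop⁺ m rs

module _ {A B : Set} where

  Causal⇒cong : {f : Stream A → Stream B} → Causal f →
                ∀ {σ τ} → σ ≈ˢ τ → f σ ≈ˢ f τ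
  Causal⇒cong c {σ} {τ} eq i = c σ τ i (λ j _ → eq j)

  derivative₁-causal : {f : Stream A → Stream B} → Causal f →
                       ∀ a → Causal (derivative₁ f a)
  derivative₁-causal c a σ τ i eq = c (a ∷ˢ σ) (a ∷ˢ τ) (suc i)
    λ { zero _ → refl ; (suc j) (s≤s j≤i) → eq j j≤i }

  derivative-causal : {f : Stream A → Stream B} → Causal f →
                      ∀ as → Causal (derivative f as)
  derivative-causal c []       = c
  derivative-causal c (a ∷ as) = derivative-causal (derivative₁-causal c a) as

  derivative-cong : {f g : Stream A → Stream B} → f ≐ g →
                    ∀ as → derivative f as ≐ derivative g as
  derivative-cong eq []       = eq
  derivative-cong eq (a ∷ as) = derivative-cong (λ σ i → eq (a ∷ˢ σ) (suc i)) as

  pointwise-causal : (h : A → B) → Causal (λ σ i → h (σ i))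
  pointwise-causal h σ τ i eq = cong h (eq i ≤-refl)

  pointwise-finitelySpecified : (h : A → B) → FinitelySpecified (λ σ i → h (σ i))
  pointwise-finitelySpecified h =
    (λ σ i → h (σ i)) ∷ [] , λ as → here (deriv as)
    where
    deriv : ∀ as → derivative (λ σ i → h (σ i)) as ≐ λ σ i → h (σ i)
    deriv []       σ i = refl
    deriv (a ∷ as)     = deriv as

module _ {A B C : Set} where

  derivative-∘ : {g : Stream B → Stream C} {f : Stream A → Stream B} →
    Causal g → Causal f → ∀ as →
    ∃[ bs ] derivative (λ σ → g (f σ)) as ≐ λ σ → derivative g bs (derivative f as σ)
  derivative-∘ cg cf [] = [] , λ σ i → refl
  derivative-∘ {g} {f} cg cf (a ∷ as) =
    let bs , eq = derivative-∘ (derivative₁-causal cg b) (derivative₁-causal cf a) as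
    in b ∷ bs , λ σ i → trans (derivative-cong step as σ i) (eq σ i)
    where
    b = f (λ _ → a) 0

    head-tail : ∀ σ → f (a ∷ˢ σ) ≈ˢ b ∷ˢ derivative₁ f a σ
    head-tail σ zero    = cf (a ∷ˢ σ) (λ _ → a) 0 λ { zero _ → refl }
    head-tail σ (suc i) = refl

    step : derivative₁ (λ σ → g (f σ)) a ≐ λ σ → derivative₁ g b (derivative₁ f a σ)
    step σ i = Causal⇒cong cg (head-tail σ) (suc i)

  ∘-causal : {g : Stream B → Stream C} {f : Stream A → Stream B} →
             Causal g → Causal f → Causal (λ σ → g (f σ))
  ∘-causal {g} {f} cg cf σ τ i eq = cg (f σ) (f τ) i λ j j≤i →
    cf σ τ j λ k k≤j → eq k (≤-trans k≤j j≤i)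

  ∘-finitelySpecified : {g : Stream B → Stream C} {f : Stream A → Stream B} →
    Causal g → Causal f → FinitelySpecified g → FinitelySpecified f →
    FinitelySpecified (λ σ → g (f σ))
  ∘-finitelySpecified {g} {f} cg cf (gs , g-fin) (fs , f-fin) =
    cartesianProductWith (λ q p σ → q (p σ)) gs fs , λ as →
    let bs , eq = derivative-∘ cg cf as in
    Any.cartesianProductWith⁺ (λ q p σ → q (p σ))
      (λ eq-q eq-p σ i → trans (eq σ i)
        (trans (Causal⇒cong (derivative-causal cg bs) (eq-p σ) i) (eq-q _ i)))
      (g-fin bs) (f-fin as)

module _ {A B : Set} {m n m′ n′ : ℕ} where

  infixr 10 _⊗ˢ_
  _⊗ˢ_ : (Stream (Vec A m) → Stream (Vec B n)) →
         (Stream (Vec A m′) → Stream (Vec B n′)) →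
         Stream (Vec A (m + m′)) → Stream (Vec B (n + n′))
  (f ⊗ˢ g) ρ = pair (f (π₀ m ρ)) (g (π₁ m ρ))

  ⊗ˢ-causal : ∀ {f g} → Causal f → Causal g → Causal (f ⊗ˢ g)
  ⊗ˢ-causal cf cg σ τ i eq = cong₂ _++_
    (cf (π₀ m σ) (π₀ m τ) i (λ j j≤i → cong (take m) (eq j j≤i)))
    (cg (π₁ m σ) (π₁ m τ) i (λ j j≤i → cong (drop m) (eq j j≤i)))

  derivative-⊗ˢ : ∀ {f g} → Causal f → Causal g → ∀ as →
    derivative (f ⊗ˢ g) as ≐
    derivative f (List.map (take m) as) ⊗ˢ derivative g (List.map (drop m) as)
  derivative-⊗ˢ cf cg [] σ i = refl
  derivative-⊗ˢ {f} {g} cf cg (a ∷ as) σ i = trans (derivative-cong step as σ i)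
    (derivative-⊗ˢ (derivative₁-causal cf (take m a))
                   (derivative₁-causal cg (drop m a)) as σ i)
    where
    step : derivative₁ (f ⊗ˢ g) a ≐
           derivative₁ f (take m a) ⊗ˢ derivative₁ g (drop m a)
    step σ i = cong₂ _++_
      (Causal⇒cong cf (λ { zero → refl ; (suc _) → refl }) (suc i))
      (Causal⇒cong cg (λ { zero → refl ; (suc _) → refl }) (suc i))

  ⊗ˢ-finitelySpecified : ∀ {f g} → Causal f → Causal g →
    FinitelySpecified f → FinitelySpecified g → FinitelySpecified (f ⊗ˢ g)
  ⊗ˢ-finitelySpecified cf cg (fs , f-fin) (gs , g-fin) =
    cartesianProductWith _⊗ˢ_ fs gs , λ as →
    Any.cartesianProductWith⁺ _⊗ˢ_
      (λ eq-p eq-q σ i → trans (derivative-⊗ˢ cf cg as σ i)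
        (cong₂ _++_ (eq-p (π₀ m σ) i) (eq-q (π₁ m σ) i)))
      (f-fin (List.map (take m) as)) (g-fin (List.map (drop m) as))

record FiniteLattice : Set₁ where
  infix 4 _⊑_
  field
    Carrier   : Set
    _⊑_       : Rel Carrier 0ℓ
    _∨_       : Op₂ Carrier
    _∧_       : Op₂ Carrier
    ⊥         : Carrier
    isLattice : IsLattice _≡_ _⊑_ _∨_ _∧_
    minimum   : Minimum _⊑_ ⊥
    size      : ℕ
    finite    : Carrier ↔ Fin size

module StreamCategory (V : FiniteLattice) where
  open FiniteLattice V

  𝐕ω : ℕ → Set
  𝐕ω n = Stream (Vec Carrier n)

  infix 4 _⊑ˢ_
  _⊑ˢ_ : ∀ {n} → Rel (𝐕ω n) 0ℓ
  σ ⊑ˢ τ = ∀ i → Pointwise _⊑_ (σ i) (τ i)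

  ⊥ˢ : ∀ {n} → 𝐕ω n
  ⊥ˢ {n} _ = replicate n ⊥

  record StreamFunction (m n : ℕ) : Set where
    field
      fun               : 𝐕ω m → 𝐕ω n
      causal            : Causal fun
      finitelySpecified : FinitelySpecified fun
      ⊥-preserving      : fun ⊥ˢ ≈ˢ ⊥ˢ
      monotone          : ∀ {σ τ} → σ ⊑ˢ τ → fun σ ⊑ˢ fun τ

    fun-cong : ∀ {σ τ} → σ ≈ˢ τ → fun σ ≈ˢ fun τ
    fun-cong = Causal⇒cong causal

  open StreamFunction public

  infix 4 _≃_
  _≃_ : ∀ {m n} → Rel (StreamFunction m n) 0ℓ
  f ≃ g = fun f ≐ fun g

  idᴴ : ∀ {n} → StreamFunction n n
  idᴴ = record
    { fun               = λ σ → σ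
    ; causal            = pointwise-causal (λ v → v)
    ; finitelySpecified = pointwise-finitelySpecified (λ v → v)
    ; ⊥-preserving      = λ i → refl
    ; monotone          = λ σ⊑τ → σ⊑τ
    }

  infixr 9 _∘ᴴ_
  _∘ᴴ_ : ∀ {m n o} → StreamFunction n o → StreamFunction m n → StreamFunction m o
  g ∘ᴴ f = record
    { fun               = λ σ → fun g (fun f σ)
    ; causal            = ∘-causal (causal g) (causal f)
    ; finitelySpecified = ∘-finitelySpecified (causal g) (causal f)
                            (finitelySpecified g) (finitelySpecified f)
    ; ⊥-preserving      = λ i → trans (fun-cong g (⊥-preserving f) i) (⊥-preserving g i)
    ; monotone          = λ σ⊑τ → monotone g (monotone f σ⊑τ)
    }

  infixr 10 _⊗ᴴ_
  _⊗ᴴ_ : ∀ {m n m′ n′} → StreamFunction m n → StreamFunction m′ n′ →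
         StreamFunction (m + m′) (n + n′)
  _⊗ᴴ_ {m} {n} {m′} {n′} f g = record
    { fun               = fun f ⊗ˢ fun g
    ; causal            = ⊗ˢ-causal (causal f) (causal g)
    ; finitelySpecified = ⊗ˢ-finitelySpecified (causal f) (causal g)
                            (finitelySpecified f) (finitelySpecified g)
    ; ⊥-preserving      = λ i → trans
        (cong₂ _++_
          (trans (fun-cong f (λ _ → take-replicate m m′ ⊥) i) (⊥-preserving f i))
          (trans (fun-cong g (λ _ → drop-replicate m m′ ⊥) i) (⊥-preserving g i)))
        (replicate-++ n n′ ⊥)
    ; monotone          = λ σ⊑τ i → Pointwise.++⁺
        (monotone f (λ j → take⁺ m (σ⊑τ j)) i)
        (monotone g (λ j → drop⁺ m (σ⊑τ j)) i)
    }

  swapⱽ : ∀ m {n} → Vec Carrier (m + n) → Vec Carrier (n + m)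
  swapⱽ m v = drop m v ++ take m v

  swapᴴ : ∀ m n → StreamFunction (m + n) (n + m)
  swapᴴ m n = record
    { fun               = λ ρ → pair (π₁ m ρ) (π₀ m ρ)
    ; causal            = pointwise-causal (swapⱽ m)
    ; finitelySpecified = pointwise-finitelySpecified (swapⱽ m)
    ; ⊥-preserving      = λ i → trans
        (cong₂ _++_ (drop-replicate m n ⊥) (take-replicate m n ⊥))
        (replicate-++ n m ⊥)
    ; monotone          = λ σ⊑τ i → Pointwise.++⁺ (drop⁺ m (σ⊑τ i)) (take⁺ m (σ⊑τ i))
    }

  coe-cast : ∀ {m n} (p : m ≡ n) σ i →
             fun (subst (StreamFunction m) p idᴴ) σ i ≡ cast p (σ i)
  coe-cast refl σ i = sym (cast-is-id refl (σ i))

  private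

    ⊗-assocᴴ : ∀ {m n o m′ n′ o′} (f : StreamFunction m m′)
      (g : StreamFunction n n′) (h : StreamFunction o o′) →
      subst (StreamFunction ((m′ + n′) + o′)) (+-assoc m′ n′ o′) idᴴ
        ∘ᴴ ((f ⊗ᴴ g) ⊗ᴴ h) ≃
      (f ⊗ᴴ (g ⊗ᴴ h)) ∘ᴴ subst (StreamFunction ((m + n) + o)) (+-assoc m n o) idᴴ
    ⊗-assocᴴ {m} {n} {o} {m′} {n′} {o′} f g h σ i =
      trans (coe-cast (+-assoc m′ n′ o′) _ i)
      (trans (++-assoc-eqFree (fun f _ i) (fun g _ i) (fun h _ i))
      (trans (cong₂ _++_
               (fun-cong f (λ j → sym (take-take m n o (σ j))) i)
               (cong₂ _++_
                 (fun-cong g (λ j → sym (take-drop m n o (σ j))) i)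
                 (fun-cong h (λ j → sym (drop-drop m n o (σ j))) i)))
             (fun-cong (f ⊗ᴴ (g ⊗ᴴ h))
               (λ j → sym (coe-cast (+-assoc m n o) σ j)) i)))

    ⊗-identityʳᴴ : ∀ {m n} (f : StreamFunction m n) →
      subst (StreamFunction (n + 0)) (+-identityʳ n) idᴴ ∘ᴴ (f ⊗ᴴ idᴴ {0}) ≃
      f ∘ᴴ subst (StreamFunction (m + 0)) (+-identityʳ m) idᴴ
    ⊗-identityʳᴴ {m} {n} f σ i =
      trans (coe-cast (+-identityʳ n) _ i)
      (trans (cast-++-unitʳ (fun f (π₀ m σ) i) (drop m (σ i)))
             (fun-cong f (λ j → trans (take-unitʳ m (σ j))
                                      (sym (coe-cast (+-identityʳ m) σ j))) i))

    swap-++ : ∀ {m n} (xs : Vec Carrier m) (ys : Vec Carrier n) →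
              swapⱽ m (xs ++ ys) ≡ ys ++ xs
    swap-++ xs ys = cong₂ _++_ (drop-++ xs ys) (take-++ xs ys)

    hexagonᴴ : ∀ m n o →
      subst (StreamFunction ((n + o) + m)) (+-assoc n o m) idᴴ ∘ᴴ
        (swapᴴ m (n + o) ∘ᴴ subst (StreamFunction ((m + n) + o)) (+-assoc m n o) idᴴ) ≃
      (idᴴ {n} ⊗ᴴ swapᴴ m o) ∘ᴴ
        (subst (StreamFunction ((n + m) + o)) (+-assoc n m o) idᴴ ∘ᴴ
          (swapᴴ m n ⊗ᴴ idᴴ {o}))
    hexagonᴴ m n o σ i =
      trans (coe-cast (+-assoc n o m) _ i)
      (trans (cong (λ w → cast (+-assoc n o m) (swapⱽ m w))
                   (coe-cast (+-assoc m n o) σ i))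
      (trans (cong (cast (+-assoc n o m))
               (cong₂ _++_
                 (trans (sym (take++drop≡id n (drop m c)))
                        (cong₂ _++_ (take-drop m n o v) (drop-drop m n o v)))
                 (take-take m n o v)))
      (trans (++-assoc-eqFree y z x)
      (trans (cong₂ _++_
               (sym (take-++ y (x ++ z)))
               (trans (sym (swap-++ x z))
                      (cong (swapⱽ m) (sym (drop-++ y (x ++ z))))))
             (cong (λ w → take n w ++ swapⱽ m (drop n w))
               (sym (trans (coe-cast (+-assoc n m o) _ i)
                           (++-assoc-eqFree y x z))))))))
      where
      v = σ i
      c = cast (+-assoc m n o) v
      x = take m (take (m + n) v)
      y = drop m (take (m + n) v)
      z = drop (m + n) v

  StreamI : SymmetricStrictMonoidalCategory 0ℓ 0ℓ 0ℓ
  StreamI = record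
    { Obj             = ℕ
    ; _⇒_             = StreamFunction
    ; _≈_             = _≃_
    ; id              = idᴴ
    ; _∘_             = _∘ᴴ_
    ; isEquivalence   = record
      { refl  = λ σ i → refl
      ; sym   = λ f≃g σ i → sym (f≃g σ i)
      ; trans = λ f≃g g≃h σ i → trans (f≃g σ i) (g≃h σ i)
      }
    ; ∘-resp-≈        = λ {_} {_} {_} {f} f≃f′ g≃g′ σ i →
                          trans (fun-cong f (g≃g′ σ) i) (f≃f′ _ i)
    ; assoc           = λ h g f σ i → refl
    ; identityˡ       = λ f σ i → refl
    ; identityʳ       = λ f σ i → refl
    ; unit            = 0
    ; _⊗₀_            = _+_
    ; ⊗₀-isMonoid     = +-0-isMonoid
    ; _⊗₁_            = _⊗ᴴ_
    ; ⊗-resp-≈        = λ f≃f′ g≃g′ σ i → cong₂ _++_ (f≃f′ _ i) (g≃g′ _ i)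
    ; ⊗-identity      = λ {m} σ i → take++drop≡id m (σ i)
    ; ⊗-∘             = λ g f g′ f′ σ i → cong₂ _++_
        (fun-cong g  (λ j → sym (take-++ (fun f _ j) (fun f′ _ j))) i)
        (fun-cong g′ (λ j → sym (drop-++ (fun f _ j) (fun f′ _ j))) i)
    ; ⊗₁-assoc        = ⊗-assocᴴ
    ; ⊗₁-identityˡ    = λ f σ i → refl
    ; ⊗₁-identityʳ    = ⊗-identityʳᴴ
    ; swap            = swapᴴ
    ; swap-natural    = λ {m} {n} f g σ i → trans
        (swap-++ (fun f _ i) (fun g _ i))
        (cong₂ _++_
          (fun-cong g (λ j → sym (take-++ (drop m (σ j)) (take m (σ j)))) i)
          (fun-cong f (λ j → sym (drop-++ (drop m (σ j)) (take m (σ j)))) i))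
    ; swap-involutive = λ m n σ i → trans
        (swap-++ (drop m (σ i)) (take m (σ i)))
        (take++drop≡id m (σ i))
    ; hexagon         = hexagonᴴ
    }

{-# OPTIONS --safe #-}
module Submission where

open import Data.Fin.Base using (Fin; zero; toℕ; combine)
open import Data.Fin.Properties using (combine-injective; pigeonhole; toℕ≤pred[n])
open import Data.List.Base as List using ([]; _∷_)
import Data.List.Relation.Unary.Any as Any
import Data.List.Relation.Unary.Any.Properties as Any
open import Data.Nat.Base
  using (ℕ; zero; suc; _+_; _^_; _∸_; z≤n; s≤s; _≤′_; ≤′-refl; ≤′-step)
open import Data.Nat.GeneralisedArithmetic using (fold)
open import Data.Nat.Properties using (+-assoc; ≤-trans; n<1+n; m∸n+n≡m; ≤⇒≤′)
open import Data.Product.Base using (Σ-syntax; ∃-syntax; _×_; _,_)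
open import Data.Vec.Base using (Vec; []; _∷_; _++_; take; drop; replicate; cast)
open import Data.Vec.Properties using (take++drop≡id; cast-sym; ++-assoc-eqFree)
open import Data.Vec.Relation.Binary.Pointwise.Inductive as Pointwise
  using (Pointwise; []; _∷_)
open import Function.Base using (_∘_)
open import Function.Bundles using (Inverse)
open import Level using (0ℓ)
open import Relation.Binary.Core using (Rel)
open import Relation.Binary.Lattice.Structures using (IsLattice)
open import Relation.Binary.PropositionalEquality
  using (_≡_; refl; sym; trans; cong; cong₂; subst; isEquivalence)
open import Relation.Binary.Structures using (IsPartialOrder)
open import Defs

-- The least fixed point μ f σ is computed one letter at a time: its head is a
-- least fixed point in the finite lattice Vˣ, its tail the least fixed point
-- for the derivative of f at the two heads.  Hence derivatives of the trace are
-- traces of derivatives, and the trace is finitely specified.  Streamwise, μ f σ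
-- is the least pre-fixed point, so each trace axiom is an order-theoretic
-- identity between parametrised least pre-fixed points.

-- Least fixed points in a finite poset with a least element.

module LeastFixedPoint
  {A : Set} {_⊑_ : Rel A 0ℓ} (po : IsPartialOrder _≡_ _⊑_)
  {⊥ : A} (⊥-least : ∀ a → ⊥ ⊑ a)
  {N : ℕ} (encode : A → Fin N) (encode-injective : ∀ {a b} → encode a ≡ encode b → a ≡ b)
  where

  private module ⊑ = IsPartialOrder po

  -- `N` bounds the number of elements, so for monotone `h` the chain of iterates from `⊥` has
  -- become constant by step `N`.
  lfp : (A → A) → A
  lfp h = fold ⊥ h N

  lfp-cong : ∀ {h k} → (∀ a → h a ≡ k a) → lfp h ≡ lfp k
  lfp-cong {h} {k} h≗k = iterates N
    where
    iterates : ∀ i → fold ⊥ h i ≡ fold ⊥ k i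
    iterates zero    = refl
    iterates (suc i) = trans (h≗k _) (cong k (iterates i))

  module _ {h : A → A} (h-mono : ∀ {a b} → a ⊑ b → h a ⊑ h b) where

    lfp-least : ∀ {a} → h a ⊑ a → lfp h ⊑ a
    lfp-least {a} ha⊑a = iterates N
      where
      iterates : ∀ i → fold ⊥ h i ⊑ a
      iterates zero    = ⊥-least a
      iterates (suc i) = ⊑.trans (h-mono (iterates i)) ha⊑a

    private
      ascending : ∀ i → fold ⊥ h i ⊑ h (fold ⊥ h i)
      ascending zero    = ⊥-least _
      ascending (suc i) = h-mono (ascending i)

      fold-mono : ∀ {i j} → i ≤′ j → fold ⊥ h i ⊑ fold ⊥ h j
      fold-mono ≤′-refl       = ⊑.refl
      fold-mono {j = suc j} (≤′-step i≤j) = ⊑.trans (fold-mono i≤j) (ascending j)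

      fixed-above : ∀ {i} → h (fold ⊥ h i) ≡ fold ⊥ h i →
                    ∀ j → h (fold ⊥ h (j + i)) ≡ fold ⊥ h (j + i)
      fixed-above eq zero    = eq
      fixed-above eq (suc j) = cong h (fixed-above eq j)

    -- Two of the first N + 1 iterates agree, so the ascending chain of
    -- iterates is constant between them, and hence from the first one on.
    lfp-fixed : h (lfp h) ≡ lfp h
    lfp-fixed with i , j , i<j , eq ← pigeonhole (n<1+n N) (encode ∘ fold ⊥ h ∘ toℕ) =
      subst (λ k → h (fold ⊥ h k) ≡ fold ⊥ h k) (m∸n+n≡m (toℕ≤pred[n] i))
        (fixed-above (⊑.antisym
          (subst (fold ⊥ h (suc (toℕ i)) ⊑_) (sym (encode-injective eq)) (fold-mono (≤⇒≤′ i<j)))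
          (ascending (toℕ i))) (N ∸ toℕ i))

-- Regrouping vectors along associativity.

module _ {A : Set} where

  cast-assoc-split : ∀ m n o (v : Vec A ((m + n) + o)) →
    cast (+-assoc m n o) v ≡
    take m (take (m + n) v) ++ (drop m (take (m + n) v) ++ drop (m + n) v)
  cast-assoc-split m n o v = trans
    (sym (trans (cong (take m c ++_) (take++drop≡id n (drop m c))) (take++drop≡id m c)))
    (cong₂ _++_ (take-take m n o v) (cong₂ _++_ (take-drop m n o v) (drop-drop m n o v)))
    where c = cast (+-assoc m n o) v

  cast-assoc⁻¹-++ : ∀ m n {o} (xs : Vec A m) (ys : Vec A (n + o)) →
    cast (sym (+-assoc m n o)) (xs ++ ys) ≡ (xs ++ take n ys) ++ drop n ys
  cast-assoc⁻¹-++ m n {o} xs ys = cast-sym (+-assoc m n o)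
    (trans (++-assoc-eqFree xs (take n ys) (drop n ys)) (cong (xs ++_) (take++drop≡id n ys)))

module StreamTrace (V : FiniteLattice) where
  open FiniteLattice V
  open StreamCategory V
  private module 𝒞 = SymmetricStrictMonoidalCategory StreamI

  -- The pointwise order on vectors and streams.

  infix 4 _⊑ⱽ_
  _⊑ⱽ_ : ∀ {n} → Rel (Vec Carrier n) 0ℓ
  _⊑ⱽ_ = Pointwise _⊑_

  ⊑ⱽ-isPartialOrder : ∀ n → IsPartialOrder _≡_ (_⊑ⱽ_ {n})
  ⊑ⱽ-isPartialOrder n = record
    { isPreorder = record
      { isEquivalence = isEquivalence
      ; reflexive     = λ { refl → Pointwise.refl ⊑.refl }
      ; trans         = Pointwise.trans ⊑.trans
      }
    ; antisym = antisym
    }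
    where
    module ⊑ = IsLattice isLattice
    antisym : ∀ {n} {u v : Vec Carrier n} → u ⊑ⱽ v → v ⊑ⱽ u → u ≡ v
    antisym []       []       = refl
    antisym (p ∷ ps) (q ∷ qs) = cong₂ _∷_ (⊑.antisym p q) (antisym ps qs)

  private module ⊑ⱽ {n : ℕ} = IsPartialOrder (⊑ⱽ-isPartialOrder n)

  replicate-⊥-least : ∀ n (v : Vec Carrier n) → replicate n ⊥ ⊑ⱽ v
  replicate-⊥-least zero    []      = []
  replicate-⊥-least (suc n) (a ∷ v) = minimum a ∷ replicate-⊥-least n v

  -- Reads a vector as an `n`-digit number in base `size`; thus `size ^ n` is the number of
  -- iterations for `lfp` on vectors.
  encode : ∀ {n} → Vec Carrier n → Fin (size ^ n)
  encode []      = zero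
  encode (a ∷ v) = combine (Inverse.to finite a) (encode v)

  encode-injective : ∀ {n} {u v : Vec Carrier n} → encode u ≡ encode v → u ≡ v
  encode-injective {u = []}    {[]}    _  = refl
  encode-injective {u = a ∷ u} {b ∷ v} eq =
    let p , q = combine-injective _ (encode u) _ (encode v) eq in
    cong₂ _∷_ (trans (sym (Inverse.inverseʳ finite refl)) (Inverse.inverseʳ finite p))
              (encode-injective q)

  private
    module Lfpⱽ {n : ℕ} =
      LeastFixedPoint (⊑ⱽ-isPartialOrder n) (replicate-⊥-least n) encode encode-injective

  ≈ˢ-sym : ∀ {n} {σ τ : 𝐕ω n} → σ ≈ˢ τ → τ ≈ˢ σ
  ≈ˢ-sym p i = sym (p i)

  ≈ˢ-trans : ∀ {n} {σ τ υ : 𝐕ω n} → σ ≈ˢ τ → τ ≈ˢ υ → σ ≈ˢ υ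
  ≈ˢ-trans p q i = trans (p i) (q i)

  ⊑ˢ-reflexive : ∀ {n} {σ τ : 𝐕ω n} → σ ≈ˢ τ → σ ⊑ˢ τ
  ⊑ˢ-reflexive p i = ⊑ⱽ.reflexive (p i)

  ⊑ˢ-refl : ∀ {n} {σ : 𝐕ω n} → σ ⊑ˢ σ
  ⊑ˢ-refl i = ⊑ⱽ.refl

  ⊑ˢ-trans : ∀ {n} {σ τ υ : 𝐕ω n} → σ ⊑ˢ τ → τ ⊑ˢ υ → σ ⊑ˢ υ
  ⊑ˢ-trans p q i = ⊑ⱽ.trans (p i) (q i)

  ⊑ˢ-antisym : ∀ {n} {σ τ : 𝐕ω n} → σ ⊑ˢ τ → τ ⊑ˢ σ → σ ≈ˢ τ
  ⊑ˢ-antisym p q i = ⊑ⱽ.antisym (p i) (q i)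

  ⊥ˢ-least : ∀ {n} {σ : 𝐕ω n} → ⊥ˢ ⊑ˢ σ
  ⊥ˢ-least i = replicate-⊥-least _ _

  ∷ˢ-mono : ∀ {n} {u v : Vec Carrier n} {σ τ : 𝐕ω n} → u ⊑ⱽ v → σ ⊑ˢ τ → u ∷ˢ σ ⊑ˢ v ∷ˢ τ
  ∷ˢ-mono p q zero    = p
  ∷ˢ-mono p q (suc i) = q i

  pair-mono : ∀ {m n} {τ τ′ : 𝐕ω m} {σ σ′ : 𝐕ω n} →
              τ ⊑ˢ τ′ → σ ⊑ˢ σ′ → pair τ σ ⊑ˢ pair τ′ σ′
  pair-mono p q i = Pointwise.++⁺ (p i) (q i)

  pair-cong : ∀ {m n} {τ τ′ : 𝐕ω m} {σ σ′ : 𝐕ω n} →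
              τ ≈ˢ τ′ → σ ≈ˢ σ′ → pair τ σ ≈ˢ pair τ′ σ′
  pair-cong p q i = cong₂ _++_ (p i) (q i)

  pair-η : ∀ m {n} (ρ : 𝐕ω (m + n)) → pair (π₀ m ρ) (π₁ m ρ) ≈ˢ ρ
  pair-η m ρ i = take++drop≡id m (ρ i)

  π₀-pair : ∀ {m n} (τ : 𝐕ω m) (σ : 𝐕ω n) → π₀ m (pair τ σ) ≈ˢ τ
  π₀-pair τ σ i = take-++ (τ i) (σ i)

  π₁-pair : ∀ {m n} (τ : 𝐕ω m) (σ : 𝐕ω n) → π₁ m (pair τ σ) ≈ˢ σ
  π₁-pair τ σ i = drop-++ (τ i) (σ i)

  π₀-mono : ∀ m {n} {ρ ρ′ : 𝐕ω (m + n)} → ρ ⊑ˢ ρ′ → π₀ m ρ ⊑ˢ π₀ m ρ′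
  π₀-mono m p i = take⁺ m (p i)

  π₁-mono : ∀ m {n} {ρ ρ′ : 𝐕ω (m + n)} → ρ ⊑ˢ ρ′ → π₁ m ρ ⊑ˢ π₁ m ρ′
  π₁-mono m p i = drop⁺ m (p i)

  π₀-cong : ∀ m {n} {ρ ρ′ : 𝐕ω (m + n)} → ρ ≈ˢ ρ′ → π₀ m ρ ≈ˢ π₀ m ρ′
  π₀-cong m p i = cong (take m) (p i)

  π₁-cong : ∀ m {n} {ρ ρ′ : 𝐕ω (m + n)} → ρ ≈ˢ ρ′ → π₁ m ρ ≈ˢ π₁ m ρ′
  π₁-cong m p i = cong (drop m) (p i)

  -- Feedback of a stream function.

  Monotone : ∀ {m n} → (𝐕ω m → 𝐕ω n) → Set
  Monotone f = ∀ {σ τ} → σ ⊑ˢ τ → f σ ⊑ˢ f τ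

  derivative₁-mono : ∀ {m n} {f : 𝐕ω m → 𝐕ω n} → Monotone f →
                     ∀ a → Monotone (derivative₁ f a)
  derivative₁-mono mf a p i = mf (∷ˢ-mono ⊑ⱽ.refl p) (suc i)

  module Feedback (x m n : ℕ) where

    -- For causal `f` the letter at position 0 depends only on the head of the argument, so the
    -- constant stream can stand for any stream with head `v ++ a`.
    headStep : (𝐕ω (x + m) → 𝐕ω (x + n)) → Vec Carrier m → Vec Carrier x → Vec Carrier x
    headStep f a v = take x (f (λ _ → v ++ a) 0)

    μ₀ : (𝐕ω (x + m) → 𝐕ω (x + n)) → Vec Carrier m → Vec Carrier x
    μ₀ f a = Lfpⱽ.lfp (headStep f a)

    -- The recursion is on the position, with `f` and `σ` varying, and the properties of `μ` are
    -- proved by induction of the same shape.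
    μ : (𝐕ω (x + m) → 𝐕ω (x + n)) → 𝐕ω m → 𝐕ω x
    μ f σ zero    = μ₀ f (σ 0)
    μ f σ (suc i) = μ (derivative₁ f (μ₀ f (σ 0) ++ σ 0)) (tl σ) i

    trace : (𝐕ω (x + m) → 𝐕ω (x + n)) → 𝐕ω m → 𝐕ω n
    trace f σ = π₁ x (f (pair (μ f σ) σ))

    μ-cong : ∀ {f g} → f ≐ g → ∀ σ → μ f σ ≈ˢ μ g σ
    μ-cong f≐g σ zero = Lfpⱽ.lfp-cong λ v → cong (take x) (f≐g _ 0)
    -- Once the heads are identified, both derivatives are taken at the same letter.
    μ-cong {f} {g} f≐g σ (suc i) rewrite μ-cong f≐g σ 0 =
      μ-cong (λ τ j → f≐g _ (suc j)) (tl σ) i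

    -- Causality is asked of `f` alone because the functions listed in `FinitelySpecified` are
    -- arbitrary; this lemma replaces a derivative by such a function.
    trace-cong : ∀ {f g} → Causal f → f ≐ g → trace f ≐ trace g
    trace-cong cf f≐g σ i = cong (drop x)
      (trans (Causal⇒cong cf (pair-cong (μ-cong f≐g σ) (λ _ → refl)) i) (f≐g _ i))

    -- The recursion that computes letter `i` reads only the letters of `σ` up to `i`.
    μ-causal : ∀ f → Causal (μ f)
    μ-causal f σ τ zero    eq = cong (μ₀ f) (eq 0 z≤n)
    μ-causal f σ τ (suc i) eq rewrite eq 0 z≤n =
      μ-causal (derivative₁ f (μ₀ f (τ 0) ++ τ 0)) (tl σ) (tl τ) i
        (λ j j≤i → eq (suc j) (s≤s j≤i))

    trace-causal : ∀ {f} → Causal f → Causal (trace f)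
    trace-causal {f} cf σ τ i eq = cong (drop x)
      (cf _ _ i λ j j≤i → cong₂ _++_
        (μ-causal f σ τ j λ k k≤j → eq k (≤-trans k≤j j≤i)) (eq j j≤i))

    -- Unfolding `μ` shows that the argument fed to `f` has head `μ₀ f a ++ a`, followed by the
    -- argument that the trace of the derivative feeds to it.
    trace-derivative₁ : ∀ {f} → Causal f → ∀ a →
      derivative₁ (trace f) a ≐ trace (derivative₁ f (μ₀ f a ++ a))
    trace-derivative₁ cf a σ i = cong (drop x)
      (Causal⇒cong cf (λ { zero → refl ; (suc j) → refl }) (suc i))

    -- The word `bs` extends each letter of `as` by the head fixed point of the derivative reached
    -- so far.
    trace-derivative : ∀ {f} → Causal f → ∀ as →
      ∃[ bs ] derivative (trace f) as ≐ trace (derivative f bs)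
    trace-derivative cf [] = [] , λ σ i → refl
    trace-derivative {f} cf (a ∷ as) =
      let bs , eq = trace-derivative (derivative₁-causal cf b) as
      in b ∷ bs , λ σ i → trans (derivative-cong (trace-derivative₁ cf a) as σ i) (eq σ i)
      where b = μ₀ f a ++ a

    trace-finitelySpecified : ∀ {f} → Causal f → FinitelySpecified f → FinitelySpecified (trace f)
    trace-finitelySpecified cf (gs , fin) = List.map trace gs , λ as →
      let bs , eq = trace-derivative cf as in
      Any.map⁺ (Any.map
        (λ eq′ σ i → trans (eq σ i) (trace-cong (derivative-causal cf bs) eq′ σ i))
        (fin bs))

    headStep-mono : ∀ {f} → Monotone f → ∀ a {u v} → u ⊑ⱽ v → headStep f a u ⊑ⱽ headStep f a v
    headStep-mono mf a p = take⁺ x (mf (λ _ → Pointwise.++⁺ p ⊑ⱽ.refl) 0)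

    μ-fixed : ∀ {f} → Causal f → Monotone f → ∀ σ → π₀ x (f (pair (μ f σ) σ)) ≈ˢ μ f σ
    μ-fixed {f} cf mf σ zero = trans
      (cong (take x) (cf _ _ 0 λ { zero _ → refl }))
      (Lfpⱽ.lfp-fixed (headStep-mono mf (σ 0)))
    μ-fixed {f} cf mf σ (suc i) = trans
      (cong (take x) (Causal⇒cong cf (λ { zero → refl ; (suc j) → refl }) (suc i)))
      (μ-fixed (derivative₁-causal cf b) (derivative₁-mono mf b) (tl σ) i)
      where b = μ₀ f (σ 0) ++ σ 0

    -- Pre-fixed points make the induction work: if the head of `τ` lies strictly above the least
    -- one, `tl τ` need not be fixed for the derivative at `b`, but by monotonicity it is still
    -- pre-fixed.
    μ-least : ∀ {f} → Causal f → Monotone f → ∀ {σ τ} →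
              π₀ x (f (pair τ σ)) ⊑ˢ τ → μ f σ ⊑ˢ τ
    μ-least {f} cf mf {σ} {τ} p zero = Lfpⱽ.lfp-least (headStep-mono mf (σ 0))
      (⊑ⱽ.trans (⊑ⱽ.reflexive (cong (take x) (cf _ _ 0 λ { zero _ → refl }))) (p 0))
    μ-least {f} cf mf {σ} {τ} p (suc i) =
      μ-least (derivative₁-causal cf b) (derivative₁-mono mf b) {tl σ} {tl τ} tail i
      where
      b = μ₀ f (σ 0) ++ σ 0
      below : b ∷ˢ pair (tl τ) (tl σ) ⊑ˢ pair τ σ
      below zero    = Pointwise.++⁺ (μ-least cf mf {σ} {τ} p 0) ⊑ⱽ.refl
      below (suc j) = ⊑ⱽ.refl
      tail : π₀ x (derivative₁ f b (pair (tl τ) (tl σ))) ⊑ˢ tl τ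
      tail j = ⊑ⱽ.trans (take⁺ x (mf below (suc j))) (p (suc j))

    -- The fixed point for the larger parameter is pre-fixed for the smaller one.
    μ-mono : ∀ {f} → Causal f → Monotone f → Monotone (μ f)
    μ-mono cf mf {σ} {τ} p = μ-least cf mf
      (⊑ˢ-trans (π₀-mono x (mf (pair-mono ⊑ˢ-refl p))) (⊑ˢ-reflexive (μ-fixed cf mf τ)))

    trace-mono : ∀ {f} → Causal f → Monotone f → Monotone (trace f)
    trace-mono cf mf p = π₁-mono x (mf (pair-mono (μ-mono cf mf p) p))

    -- Reduces the computation of a trace to order theory: split `f` at the parameter `σ` into a
    -- feedback part `p` and an output part `q`, then exhibit the least pre-fixed point `ρ` of `p`.
    trace-unique : ∀ {f} → Causal f → Monotone f → ∀ {σ ρ} →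
      (p : 𝐕ω x → 𝐕ω x) (q : 𝐕ω x → 𝐕ω n) →
      (∀ τ → f (pair τ σ) ≈ˢ pair (p τ) (q τ)) →
      p ρ ⊑ˢ ρ → (∀ τ → p τ ⊑ˢ τ → ρ ⊑ˢ τ) → trace f σ ≈ˢ q ρ
    trace-unique {f} cf mf {σ} {ρ} p q f≈ prefixed least = ≈ˢ-trans
      (π₁-cong x (≈ˢ-trans (Causal⇒cong cf (pair-cong μ≈ρ (λ _ → refl))) (f≈ ρ)))
      (π₁-pair (p ρ) (q ρ))
      where
      π₀f≈p : ∀ τ → π₀ x (f (pair τ σ)) ≈ˢ p τ
      π₀f≈p τ = ≈ˢ-trans (π₀-cong x (f≈ τ)) (π₀-pair (p τ) (q τ))
      μ≈ρ : μ f σ ≈ˢ ρ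
      μ≈ρ = ⊑ˢ-antisym
        (μ-least cf mf (⊑ˢ-trans (⊑ˢ-reflexive (π₀f≈p ρ)) prefixed))
        (least (μ f σ) (⊑ˢ-reflexive (≈ˢ-trans (≈ˢ-sym (π₀f≈p _)) (μ-fixed cf mf σ))))

    -- As `f` sends `⊥ˢ` to `⊥ˢ`, the least pre-fixed point of the feedback is `⊥ˢ` itself.
    trace-⊥-preserving : ∀ {f} → Causal f → Monotone f → f ⊥ˢ ≈ˢ ⊥ˢ → trace f ⊥ˢ ≈ˢ ⊥ˢ
    trace-⊥-preserving {f} cf mf f⊥ = ≈ˢ-trans
      (trace-unique cf mf (λ τ → π₀ x (f (pair τ ⊥ˢ))) (λ τ → π₁ x (f (pair τ ⊥ˢ)))
        (λ τ → ≈ˢ-sym (pair-η x _))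
        (⊑ˢ-reflexive (≈ˢ-trans (π₀-cong x f⊥⊥) (λ _ → take-replicate x n ⊥)))
        (λ τ _ → ⊥ˢ-least))
      (≈ˢ-trans (π₁-cong x f⊥⊥) (λ _ → drop-replicate x n ⊥))
      where
      f⊥⊥ : f (pair {m = x} {n = m} ⊥ˢ ⊥ˢ) ≈ˢ ⊥ˢ
      f⊥⊥ = ≈ˢ-trans (Causal⇒cong cf (λ _ → replicate-++ x m ⊥)) f⊥

  -- The trace operator on `StreamI`.

  Trᴴ : TraceOperator StreamI
  Trᴴ x m n f = record
    { fun               = trace (fun f)
    ; causal            = trace-causal (causal f)
    ; finitelySpecified = trace-finitelySpecified (causal f) (finitelySpecified f)
    ; ⊥-preserving      = trace-⊥-preserving (causal f) (monotone f) (⊥-preserving f)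
    ; monotone          = trace-mono (causal f) (monotone f)
    }
    where open Feedback x m n

  open Feedback using (μ)

  μ-isLeastFixedPoint : ∀ x m n (f : StreamFunction (x + m) (x + n)) (σ : 𝐕ω m) →
    IsLeastFixedPoint _≈ˢ_ _⊑ˢ_ (λ τ → π₀ x (fun f (pair τ σ))) (μ x m n (fun f) σ)
  μ-isLeastFixedPoint x m n f σ = record
    { fixed = Feedback.μ-fixed x m n (causal f) (monotone f) σ
    ; least = λ τ fτ≈τ →
        Feedback.μ-least x m n (causal f) (monotone f) (⊑ˢ-reflexive fτ≈τ)
    }

  -- Associators act letterwise as casts that regroup three blocks; this eliminates them from the
  -- second vanishing axiom and from superposing.
  pair-α : ∀ x {a b c d} (f : StreamFunction ((x + a) + c) ((x + b) + d)) τ ω →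
    let ρ = fun f (pair (pair τ (π₀ a ω)) (π₁ a ω)) in
    fun (𝒞.α x b d ∘ᴴ (f ∘ᴴ 𝒞.α⁻¹ x a c)) (pair τ ω) ≈ˢ
    pair (π₀ x (π₀ (x + b) ρ)) (pair (π₁ x (π₀ (x + b) ρ)) (π₁ (x + b) ρ))
  pair-α x {a} {b} {c} {d} f τ ω i = trans
    (coe-cast (+-assoc x b d) _ i)
    (trans (cong (cast (+-assoc x b d)) (fun-cong f (λ j → trans
              (coe-cast (sym (+-assoc x a c)) (pair τ ω) j)
              (cast-assoc⁻¹-++ x a (τ j) (ω j))) i))
           (cast-assoc-split x b d _))

  -- The trace axioms.

  module _ {x m n : ℕ} (f : StreamFunction (x + m) (x + n)) {σ : 𝐕ω m} where

    Trᴴ-unique : ∀ {ρ} (p : 𝐕ω x → 𝐕ω x) (q : 𝐕ω x → 𝐕ω n) →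
      (∀ τ → fun f (pair τ σ) ≈ˢ pair (p τ) (q τ)) →
      p ρ ⊑ˢ ρ → (∀ τ → p τ ⊑ˢ τ → ρ ⊑ˢ τ) → fun (Trᴴ x m n f) σ ≈ˢ q ρ
    Trᴴ-unique = Feedback.trace-unique x m n (causal f) (monotone f)

    μ-fixedᴴ : π₀ x (fun f (pair (μ x m n (fun f) σ) σ)) ≈ˢ μ x m n (fun f) σ
    μ-fixedᴴ = Feedback.μ-fixed x m n (causal f) (monotone f) σ

    μ-leastᴴ : ∀ {τ} → π₀ x (fun f (pair τ σ)) ⊑ˢ τ → μ x m n (fun f) σ ⊑ˢ τ
    μ-leastᴴ = Feedback.μ-least x m n (causal f) (monotone f)

  -- On both sides the feedback part is that of `f` at the parameter `fun g σ`, and `h` touches only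
  -- the output.
  Trᴴ-tightening : ∀ x {a b c d} (g : StreamFunction a b)
    (f : StreamFunction (x + b) (x + c)) (h : StreamFunction c d) →
    Trᴴ x a d ((idᴴ {x} ⊗ᴴ h) ∘ᴴ (f ∘ᴴ (idᴴ {x} ⊗ᴴ g))) ≃ h ∘ᴴ (Trᴴ x b c f ∘ᴴ g)
  Trᴴ-tightening x {a} {b} {c} {d} g f h σ =
    Trᴴ-unique {x} {a} {d} ((idᴴ {x} ⊗ᴴ h) ∘ᴴ (f ∘ᴴ (idᴴ {x} ⊗ᴴ g)))
      (λ τ → π₀ x (F τ)) (λ τ → fun h (π₁ x (F τ)))
      (λ τ → let eq = fun-cong f (inner τ) in
        pair-cong (π₀-cong x eq) (fun-cong h (π₁-cong x eq)))
      (⊑ˢ-reflexive (μ-fixedᴴ {x} {b} {c} f))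
      (λ τ → μ-leastᴴ {x} {b} {c} f)
    where
    F : 𝐕ω x → 𝐕ω (x + c)
    F τ = fun f (pair τ (fun g σ))
    inner : ∀ τ → pair (π₀ x (pair τ σ)) (fun g (π₁ x (pair τ σ))) ≈ˢ pair τ (fun g σ)
    inner τ = pair-cong (π₀-pair τ σ) (fun-cong g (π₁-pair τ σ))

  -- The rolling rule: for monotone `u` and `k`, `u` sends the least pre-fixed point of `k ∘ u` to
  -- that of `u ∘ k`. Here `k` is `π₀ y` after `F`.
  Trᴴ-sliding : ∀ {x y a b} (f : StreamFunction (x + a) (y + b)) (u : StreamFunction y x) →
    Trᴴ x a b ((u ⊗ᴴ idᴴ {b}) ∘ᴴ f) ≃ Trᴴ y a b (f ∘ᴴ (u ⊗ᴴ idᴴ {a}))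
  Trᴴ-sliding {x} {y} {a} {b} f u σ = ≈ˢ-trans
    (Trᴴ-unique {x} {a} {b} ((u ⊗ᴴ idᴴ {b}) ∘ᴴ f)
      (λ τ → fun u (π₀ y (F τ))) (λ τ → π₁ y (F τ)) (λ τ i → refl)
      (⊑ˢ-reflexive (fun-cong u (≈ˢ-trans (π₀-cong y (≈ˢ-sym (inner υ))) (μ-fixedᴴ {y} {a} {b} G))))
      -- If `u (k τ)` lies below `τ`, then `k τ` is pre-fixed for `k ∘ u`, hence above `υ`; applying
      -- `u` gives the bound.
      (λ τ uFτ⊑τ → ⊑ˢ-trans
        (monotone u (μ-leastᴴ {y} {a} {b} G (π₀-mono y (⊑ˢ-trans
          (⊑ˢ-reflexive (inner (π₀ y (F τ))))
          (monotone f (pair-mono uFτ⊑τ ⊑ˢ-refl))))))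
        uFτ⊑τ))
    (π₁-cong y (≈ˢ-sym (inner υ)))
    where
    G : StreamFunction (y + a) (y + b)
    G = f ∘ᴴ (u ⊗ᴴ idᴴ {a})
    υ : 𝐕ω y
    υ = μ y a b (fun G) σ
    F : 𝐕ω x → 𝐕ω (y + b)
    F τ = fun f (pair τ σ)
    inner : ∀ υ → fun G (pair υ σ) ≈ˢ F (fun u υ)
    inner υ = fun-cong f (pair-cong (fun-cong u (π₀-pair υ σ)) (π₁-pair υ σ))

  -- The fed-back stream consists of empty vectors, and the left unitors reduce to identities.
  Trᴴ-vanishing-unit : ∀ {a b} (f : StreamFunction (0 + a) (0 + b)) →
    Trᴴ 0 a b f ≃ 𝒞.lu b ∘ᴴ (f ∘ᴴ 𝒞.lu⁻¹ a)
  Trᴴ-vanishing-unit {a} {b} f σ = fun-cong f λ i → cong (_++ σ i) (empty (μ 0 a b (fun f) σ i))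
    where
    empty : (v : Vec Carrier 0) → v ≡ []
    empty [] = refl

  -- Bekić's lemma: a simultaneous least fixed point can be computed by
  -- first solving for one component and then for the other.
  Trᴴ-vanishing-⊗ : ∀ x y {a b} (f : StreamFunction ((x + y) + a) ((x + y) + b)) →
    Trᴴ (x + y) a b f ≃
    Trᴴ y a b (Trᴴ x (y + a) (y + b) (𝒞.α x y b ∘ᴴ (f ∘ᴴ 𝒞.α⁻¹ x y a)))
  Trᴴ-vanishing-⊗ x y {a} {b} f σ = ≈ˢ-trans
    (Trᴴ-unique {x + y} {a} {b} f {ρ = pair (N υ₀) υ₀}
      (λ τ → π₀ (x + y) (fun f (pair τ σ))) (λ τ → π₁ (x + y) (fun f (pair τ σ)))
      (λ τ → ≈ˢ-sym (pair-η (x + y) _))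
      (⊑ˢ-reflexive (≈ˢ-trans (≈ˢ-sym (pair-η x _)) (pair-cong (N-fixed υ₀) υ₀-fixed)))
      (λ τ fτ⊑τ → least (π₀ x τ) (π₁ x τ) τ (pair-η x τ) fτ⊑τ))
    (≈ˢ-sym (≈ˢ-trans (π₁-cong y (H-pair υ₀)) (π₁-pair (KY (N υ₀) υ₀) _)))
    where
    G : StreamFunction (x + (y + a)) (x + (y + b))
    G = 𝒞.α x y b ∘ᴴ (f ∘ᴴ 𝒞.α⁻¹ x y a)

    H : StreamFunction (y + a) (y + b)
    H = Trᴴ x (y + a) (y + b) G

    K : 𝐕ω x → 𝐕ω y → 𝐕ω ((x + y) + b)
    K τ υ = fun f (pair (pair τ υ) σ)

    K-mono : ∀ {τ τ′ υ υ′} → τ ⊑ˢ τ′ → υ ⊑ˢ υ′ → K τ υ ⊑ˢ K τ′ υ′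
    K-mono p q = monotone f (pair-mono (pair-mono p q) ⊑ˢ-refl)

    -- Solves for the first component with the second as a parameter; the joint solution will be
    -- `pair (N υ₀) υ₀`.
    N : 𝐕ω y → 𝐕ω x
    N υ = μ x (y + a) (y + b) (fun G) (pair υ σ)

    N-mono : Monotone N
    N-mono p = Feedback.μ-mono x (y + a) (y + b) (causal G) (monotone G) (pair-mono p ⊑ˢ-refl)

    υ₀ : 𝐕ω y
    υ₀ = μ y a b (fun H) σ

    KX : 𝐕ω x → 𝐕ω y → 𝐕ω x
    KX τ υ = π₀ x (π₀ (x + y) (K τ υ))

    KY : 𝐕ω x → 𝐕ω y → 𝐕ω y
    KY τ υ = π₁ x (π₀ (x + y) (K τ υ))

    G-pair : ∀ τ υ → fun G (pair τ (pair υ σ)) ≈ˢ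
                     pair (KX τ υ) (pair (KY τ υ) (π₁ (x + y) (K τ υ)))
    G-pair τ υ = ≈ˢ-trans (pair-α x {y} {y} {a} {b} f τ (pair υ σ))
      (pair-cong (π₀-cong x (π₀-cong (x + y) eq))
        (pair-cong (π₁-cong x (π₀-cong (x + y) eq)) (π₁-cong (x + y) eq)))
      where
      eq = fun-cong f (pair-cong (pair-cong {τ = τ} (λ _ → refl) (π₀-pair υ σ)) (π₁-pair υ σ))

    N-fixed : ∀ υ → KX (N υ) υ ≈ˢ N υ
    N-fixed υ = ≈ˢ-trans
      (≈ˢ-sym (≈ˢ-trans (π₀-cong x (G-pair (N υ) υ)) (π₀-pair _ _)))
      (μ-fixedᴴ {x} {y + a} {y + b} G)

    N-least : ∀ {τ υ} → KX τ υ ⊑ˢ τ → N υ ⊑ˢ τ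
    N-least {τ} {υ} p = μ-leastᴴ {x} {y + a} {y + b} G
      (⊑ˢ-trans (⊑ˢ-reflexive (≈ˢ-trans (π₀-cong x (G-pair τ υ)) (π₀-pair _ _))) p)

    H-pair : ∀ υ → fun H (pair υ σ) ≈ˢ pair (KY (N υ) υ) (π₁ (x + y) (K (N υ) υ))
    H-pair υ = ≈ˢ-trans (π₁-cong x (G-pair (N υ) υ)) (π₁-pair (KX (N υ) υ) _)

    υ₀-fixed : KY (N υ₀) υ₀ ≈ˢ υ₀
    υ₀-fixed = ≈ˢ-trans
      (≈ˢ-sym (≈ˢ-trans (π₀-cong y (H-pair υ₀)) (π₀-pair _ _)))
      (μ-fixedᴴ {y} {a} {b} H)

    υ₀-least : ∀ {υ} → KY (N υ) υ ⊑ˢ υ → υ₀ ⊑ˢ υ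
    υ₀-least {υ} p = μ-leastᴴ {y} {a} {b} H
      (⊑ˢ-trans (⊑ˢ-reflexive (≈ˢ-trans (π₀-cong y (H-pair υ)) (π₀-pair _ _))) p)

    -- For a pre-fixed pair, `N υ` lies below `τ`. Lowering `τ` to `N υ` keeps `υ` pre-fixed in the
    -- second component, so `υ₀` lies below `υ`, and monotonicity of `N` bounds `N υ₀` by `τ`.
    least : ∀ τ υ ρ → pair τ υ ≈ˢ ρ → π₀ (x + y) (fun f (pair ρ σ)) ⊑ˢ ρ →
            pair (N υ₀) υ₀ ⊑ˢ ρ
    least τ υ ρ eq p =
      ⊑ˢ-trans (pair-mono (⊑ˢ-trans (N-mono υ₀⊑υ) Nυ⊑τ) υ₀⊑υ) (⊑ˢ-reflexive eq)
      where
      Kτυ⊑τυ : π₀ (x + y) (K τ υ) ⊑ˢ pair τ υ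
      Kτυ⊑τυ = ⊑ˢ-trans
        (⊑ˢ-reflexive (π₀-cong (x + y) (fun-cong f (pair-cong eq (λ _ → refl)))))
        (⊑ˢ-trans p (⊑ˢ-reflexive (≈ˢ-sym eq)))
      Nυ⊑τ : N υ ⊑ˢ τ
      Nυ⊑τ = N-least (⊑ˢ-trans (π₀-mono x Kτυ⊑τυ) (⊑ˢ-reflexive (π₀-pair τ υ)))
      υ₀⊑υ : υ₀ ⊑ˢ υ
      υ₀⊑υ = υ₀-least (⊑ˢ-trans
        (π₁-mono x (π₀-mono (x + y) (K-mono Nυ⊑τ ⊑ˢ-refl)))
        (⊑ˢ-trans (π₁-mono x Kτυ⊑τυ) (⊑ˢ-reflexive (π₁-pair τ υ))))

  -- `g` acts outside the loop, so the feedback part is that of `f` at `π₀ a σ`.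
  Trᴴ-superposing : ∀ x {a b c d} (f : StreamFunction (x + a) (x + b)) (g : StreamFunction c d) →
    Trᴴ x (a + c) (b + d) (𝒞.α x b d ∘ᴴ ((f ⊗ᴴ g) ∘ᴴ 𝒞.α⁻¹ x a c)) ≃ Trᴴ x a b f ⊗ᴴ g
  Trᴴ-superposing x {a} {b} {c} {d} f g σ =
    Trᴴ-unique {x} {a + c} {b + d} (𝒞.α x b d ∘ᴴ ((f ⊗ᴴ g) ∘ᴴ 𝒞.α⁻¹ x a c))
      (λ τ → π₀ x (F τ)) (λ τ → pair (π₁ x (F τ)) (fun g (π₁ a σ)))
      (λ τ → ≈ˢ-trans (pair-α x {a} {b} {c} {d} (f ⊗ᴴ g) τ σ)
        (pair-cong (π₀-cong x (f-part τ)) (pair-cong (π₁-cong x (f-part τ)) (g-part τ))))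
      (⊑ˢ-reflexive (μ-fixedᴴ {x} {a} {b} f))
      (λ τ → μ-leastᴴ {x} {a} {b} f)
    where
    F : 𝐕ω x → 𝐕ω (x + b)
    F τ = fun f (pair τ (π₀ a σ))
    ρ : 𝐕ω x → 𝐕ω ((x + a) + c)
    ρ τ = pair (pair τ (π₀ a σ)) (π₁ a σ)
    f-part : ∀ τ → π₀ (x + b) (fun (f ⊗ᴴ g) (ρ τ)) ≈ˢ F τ
    f-part τ = ≈ˢ-trans (π₀-pair (fun f (π₀ (x + a) (ρ τ))) (fun g (π₁ (x + a) (ρ τ))))
      (fun-cong f (π₀-pair (pair τ (π₀ a σ)) (π₁ a σ)))
    g-part : ∀ τ → π₁ (x + b) (fun (f ⊗ᴴ g) (ρ τ)) ≈ˢ fun g (π₁ a σ)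
    g-part τ = ≈ˢ-trans (π₁-pair (fun f (π₀ (x + a) (ρ τ))) (fun g (π₁ (x + a) (ρ τ))))
      (fun-cong g (π₁-pair (pair τ (π₀ a σ)) (π₁ a σ)))

  -- The feedback part of the swap is constantly `σ`, so its least pre-fixed point is `σ`, and the
  -- output returns the fed-back stream.
  Trᴴ-yanking : ∀ x → Trᴴ x x x (swapᴴ x x) ≃ idᴴ
  Trᴴ-yanking x σ = Trᴴ-unique {x} {x} {x} (swapᴴ x x) (λ _ → σ) (λ τ → τ)
    (λ τ → pair-cong (π₁-pair τ σ) (π₀-pair τ σ)) ⊑ˢ-refl (λ τ p → p)

  Trᴴ-isTrace : IsTrace StreamI Trᴴ
  Trᴴ-isTrace = record
    { resp-≈         = λ x m n {f} → Feedback.trace-cong x m n (causal f)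
    ; tightening     = Trᴴ-tightening
    ; sliding        = Trᴴ-sliding
    ; vanishing-unit = Trᴴ-vanishing-unit
    ; vanishing-⊗    = Trᴴ-vanishing-⊗
    ; superposing    = Trᴴ-superposing
    ; yanking        = Trᴴ-yanking
    }

theorem4p48 : (V : FiniteLattice) → let open StreamCategory V in
    Σ[ Tr ∈ TraceOperator StreamI ]
    (∀ (x m n : ℕ) (f : StreamFunction (x + m) (x + n)) (σ : 𝐕ω m) →
    ∃[ μ ] IsLeastFixedPoint _≈ˢ_ _⊑ˢ_ (λ τ → π₀ x (fun f (pair τ σ))) μ
    × fun (Tr x m n f) σ ≈ˢ π₁ x (fun f (pair μ σ)))
    × IsTrace StreamI Tr
theorem4p48 V =
  Trᴴ , (λ x m n f σ → μ x m n (fun f) σ , μ-isLeastFixedPoint x m n f σ , λ i → refl) , Trᴴ-isTrace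
  where
  open StreamCategory V
  open StreamTrace V
  open Feedback using (μ)
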